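{- Let $n$ be a positive integer, let $\lambda$ be a partition of $n$, and let $\mathfrak{S}_n(\lambda)$ be the set of permutations in $\mathfrak{S}_n$ of cycle type $\lambda$. Then, for any integer $i\ge0$, the coefficient of $s^i$ in $$\sum_{\pi\in\mathfrak{S}_n(\lambda)}s^{\mathrm{cval}(\pi)}t^{\mathrm{exc}(\pi)}$$ is a $\gamma$-positive polynomial in $t$.
   Context: $[n]=\{1,\dots,n\}$ and $\mathfrak{S}_n$ is the symmetric group on $[n]$. For $\pi\in\mathfrak{S}_n$, an excedance of $\pi$ is an $i\in[n]$ with $i<\pi(i)$, and $\mathrm{exc}(\pi)$ is the number of excedances. A cyclic valley of $\pi$ is an $i\in[n]$ with $\pi^{ -1}(i)>i<\pi(i)$, and $\mathrm{cval}(\pi)$ is the number of cyclic valleys. A polynomial $f(t)$ is $\gamma$-positive (with center of symmetry $m/2$, for some integer $m\ge0$) if it can be written as $f(t)=\sum_{j=0}^{\lfloor m/2\rfloor}\gamma_j t^j(1+t)^{m-2j}$ for some non-negative integers $\gamma_j$. (The zero polynomial is $\gamma$-positive under this definition.) -}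

module Defs where

open import Algebra.Bundles using (RawSemiring)
import Algebra.Definitions.RawSemiring as SemiringOps
open import Data.Fin.Base as Fin using (Fin; zero; toℕ; fromℕ<)
import Data.Fin.Properties as Fin
open import Data.Fin.Permutation
  using (Permutation′; _⟨$⟩ʳ_; _⟨$⟩ˡ_; insert; remove; insert-remove)
  renaming (id to idₚ; _≈_ to _≈ₚ_)
open import Data.Integer.Base as ℤ using (ℤ; +_)
open import Data.List.Base
  using (List; []; _∷_; map; foldr; filter; length; allFin; cartesianProductWith)
open import Data.List.Membership.Propositional.Properties using (∈-allFin)
open import Data.List.Properties using (≡-dec)
open import Data.List.Relation.Binary.Permutation.Propositional
  using (_↭_; ↭-sym; ↭-trans; ↭-reflexive; ↭⇒↭ₛ)
open import Data.List.Relation.Binary.Pointwise using (Pointwise-≡⇒≡)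
open import Data.List.Relation.Unary.All using (All; []; _∷_)
open import Data.List.Relation.Unary.AllPairs using ([]; _∷_)
open import Data.List.Relation.Unary.Any using (Any; here)
import Data.List.Relation.Unary.Any.Properties as Any
open import Data.List.Relation.Unary.Linked using (Linked)
open import Data.List.Relation.Unary.Sorted.TotalOrder.Properties using (↗↭↗⇒≋)
import Data.List.Relation.Unary.Unique.Propositional.Properties as Unique
import Data.List.Relation.Unary.Unique.Setoid as UniqueSetoid
import Data.List.Relation.Unary.Unique.Setoid.Properties as UniqueSetoid
open import Data.Nat.Base as ℕ using (ℕ; zero; suc; _+_; _*_; _∸_; ⌊_/2⌋; NonZero; >-nonZero)
import Data.Nat.Properties as ℕ
open import Data.Nat.DivMod using (_/_; _%_; m≡m%n+[m/n]*n; m%n<n)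
open import Data.Nat.ListAction using (sum)
open import Data.Nat.GeneralisedArithmetic using (fold; fold-+)
open import Data.Product.Base using (∃; _×_; _,_)
open import Data.Vec.Functional using (Vector)
open import Function.Bundles using (Injection)
open import Function.Properties.Inverse using (↔⇒↣)
open import Level using (Level; 0ℓ)
open import Relation.Binary.Bundles using (Setoid)
open import Relation.Binary.PropositionalEquality
  using (_≡_; refl; sym; trans; cong; subst; setoid)
open import Relation.Nullary.Decidable using (Dec; map′; _×-dec_; _→-dec_)
open import Relation.Unary using (Decidable)

open import Data.List.Sort.InsertionSort ℕ.≤-decTotalOrder using (insertionSort)
open import Data.List.Sort.Base ℕ.≤-totalOrder using (module SortingAlgorithm)
open SortingAlgorithm insertionSort using (sort; sort-↭; sort-↗)

private
  variable
    a ℓ : Level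
    n : ℕ

-- Coefficient lists, constant term first. Trailing zeros are allowed, so
-- polynomials are compared coefficientwise.

module _ (R : RawSemiring a ℓ) where
  private module R = RawSemiring R

  coefficient : List R.Carrier → ℕ → R.Carrier
  coefficient []      _       = R.0#
  coefficient (x ∷ p) zero    = x
  coefficient (x ∷ p) (suc k) = coefficient p k

  addPoly : List R.Carrier → List R.Carrier → List R.Carrier
  addPoly []      q       = q
  addPoly (x ∷ p) []      = x ∷ p
  addPoly (x ∷ p) (y ∷ q) = (x R.+ y) ∷ addPoly p q

  mulPoly : List R.Carrier → List R.Carrier → List R.Carrier
  mulPoly []      q = []
  mulPoly (x ∷ p) q = addPoly (map (x R.*_) q) (R.0# ∷ mulPoly p q)

  constant : R.Carrier → List R.Carrier
  constant x = x ∷ []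

  indeterminate : List R.Carrier
  indeterminate = R.0# ∷ R.1# ∷ []

  polynomials : RawSemiring a ℓ
  polynomials = record
    { Carrier = List R.Carrier
    ; _≈_     = λ p q → ∀ k → coefficient p k R.≈ coefficient q k
    ; _+_     = addPoly
    ; _*_     = mulPoly
    ; 0#      = []
    ; 1#      = constant R.1#
    }

ℤ[t] : RawSemiring 0ℓ 0ℓ
ℤ[t] = polynomials ℤ.+-*-rawSemiring

ℤ[t][s] : RawSemiring 0ℓ 0ℓ
ℤ[t][s] = polynomials ℤ[t]

module ℤ[t] where
  open RawSemiring ℤ[t] public
  open SemiringOps ℤ[t] public using (_^_) renaming (sum to ∑)

  const : ℤ → Carrier
  const = constant ℤ.+-*-rawSemiring

  t : Carrier
  t = indeterminate ℤ.+-*-rawSemiring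

module ℤ[t][s] where
  open RawSemiring ℤ[t][s] public
  open SemiringOps ℤ[t][s] public using (_^_)

  const : ℤ[t].Carrier → Carrier
  const = constant ℤ[t]

  s : Carrier
  s = indeterminate ℤ[t]

  [s^_]_ : ℕ → Carrier → ℤ[t].Carrier
  [s^ i ] F = coefficient ℤ[t] F i

γ-Positive : ℤ[t].Carrier → Set
γ-Positive f =
  ∃ λ (m : ℕ) → ∃ λ (γ : Vector ℕ (suc ⌊ m /2⌋)) →
    f ≈ ∑ (λ j → const (+ γ j) ⊗ (t ^ toℕ j ⊗ (1# ⊕ t) ^ (m ∸ 2 * toℕ j)))
  where open ℤ[t] renaming (_+_ to _⊕_; _*_ to _⊗_)

-- Fin n stands for [n]: the statistics depend only on the order.

IsExcedance : Permutation′ n → Fin n → Set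
IsExcedance π i = i Fin.< π ⟨$⟩ʳ i

isExcedance? : (π : Permutation′ n) → Decidable (IsExcedance π)
isExcedance? π i = i Fin.<? π ⟨$⟩ʳ i

exc : Permutation′ n → ℕ
exc π = length (filter (isExcedance? π) (allFin _))

IsCyclicValley : Permutation′ n → Fin n → Set
IsCyclicValley π i = (π ⟨$⟩ˡ i Fin.> i) × (i Fin.< π ⟨$⟩ʳ i)

isCyclicValley? : (π : Permutation′ n) → Decidable (IsCyclicValley π)
isCyclicValley? π i = (i Fin.<? π ⟨$⟩ˡ i) ×-dec (i Fin.<? π ⟨$⟩ʳ i)

cval : Permutation′ n → ℕ
cval π = length (filter (isCyclicValley? π) (allFin _))

infix 25 _^_·_

_^_·_ : Permutation′ n → ℕ → Fin n → Fin n
π ^ k · i = fold i (π ⟨$⟩ʳ_) k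

-- Negative powers are not needed, since π has finite order.

SameCycle : Permutation′ n → Fin n → Fin n → Set
SameCycle π i j = ∃ λ k → π ^ k · i ≡ j

^-injective : (π : Permutation′ n) → ∀ k {i j} → π ^ k · i ≡ π ^ k · j → i ≡ j
^-injective π zero    eq = eq
^-injective π (suc k) eq = ^-injective π k (Injection.injective (↔⇒↣ π) eq)

period : (π : Permutation′ n) (i : Fin n) →
         ∃ λ p → NonZero p × p ℕ.≤ n × π ^ p · i ≡ i
period {n} π i
  with a , b , a<b , eq ← Fin.pigeonhole (ℕ.n<1+n n) (λ k → π ^ toℕ k · i)
  = toℕ b ∸ toℕ a
  , >-nonZero (ℕ.m<n⇒0<n∸m a<b)
  , ℕ.≤-trans (ℕ.m∸n≤m (toℕ b) (toℕ a)) (Fin.toℕ≤pred[n] b)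
  , ^-injective π (toℕ a)
      (trans (sym (fold-+ i (π ⟨$⟩ʳ_) (toℕ a)))
      (trans (cong (π ^_· i) (ℕ.m+[n∸m]≡n (ℕ.<⇒≤ a<b))) (sym eq)))

^-multiple : (π : Permutation′ n) → ∀ {i} q p → π ^ p · i ≡ i → π ^ (q * p) · i ≡ i
^-multiple π         zero    p eq = refl
^-multiple π {i = i} (suc q) p eq =
  trans (fold-+ i (π ⟨$⟩ʳ_) p) (trans (cong (π ^ p ·_) (^-multiple π q p eq)) eq)

bounded : (π : Permutation′ n) → ∀ {i j} →
          SameCycle π i j → ∃ λ (k : Fin n) → π ^ toℕ k · i ≡ j
bounded {n} π {i} (k , refl) with p , p≢0 , p≤n , eq ← period π i = reduce {{p≢0}}
  where
  reduce : {{_ : NonZero p}} → ∃ λ (l : Fin n) → π ^ toℕ l · i ≡ π ^ k · i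
  reduce = fromℕ< r<n , trans (cong (π ^_· i) (Fin.toℕ-fromℕ< r<n)) (sym same)
    where
    r<n : k % p ℕ.< n
    r<n = ℕ.<-≤-trans (m%n<n k p) p≤n

    same : π ^ k · i ≡ π ^ (k % p) · i
    same = trans (cong (π ^_· i) (m≡m%n+[m/n]*n k p))
           (trans (fold-+ i (π ⟨$⟩ʳ_) (k % p))
                  (cong (π ^ (k % p) ·_) (^-multiple π (k / p) p eq)))

sameCycle? : (π : Permutation′ n) (i j : Fin n) → Dec (SameCycle π i j)
sameCycle? π i j =
  map′ (λ (k , eq) → toℕ k , eq) (bounded π) (Fin.any? λ k → π ^ toℕ k · i Fin.≟ j)

cycleLength : Permutation′ n → Fin n → ℕ
cycleLength π i = length (filter (sameCycle? π i) (allFin _))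

IsCycleMinimum : Permutation′ n → Fin n → Set
IsCycleMinimum π i = ∀ j → SameCycle π i j → i Fin.≤ j

isCycleMinimum? : (π : Permutation′ n) → Decidable (IsCycleMinimum π)
isCycleMinimum? π i = Fin.all? λ j → sameCycle? π i j →-dec i Fin.≤? j

-- One entry per cycle, each cycle being represented by its minimum.

cycleLengths : Permutation′ n → List ℕ
cycleLengths π = map (cycleLength π) (filter (isCycleMinimum? π) (allFin _))

record Partition (n : ℕ) : Set where
  field
    parts      : List ℕ
    decreasing : Linked ℕ._≥_ parts
    positive   : All (ℕ._> 0) parts
    sum≡n      : sum parts ≡ n

open Partition public

HasCycleType : Partition n → Permutation′ n → Set
HasCycleType μ π = cycleLengths π ↭ parts μ

_↭?_ : (xs ys : List ℕ) → Dec (xs ↭ ys)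
xs ↭? ys = map′
  (λ eq → ↭-trans (↭-sym (sort-↭ xs)) (↭-trans (↭-reflexive eq) (sort-↭ ys)))
  (λ xs↭ys → Pointwise-≡⇒≡ (↗↭↗⇒≋ ℕ.≤-totalOrder (sort-↗ xs) (sort-↗ ys)
    (↭⇒↭ₛ (↭-trans (sort-↭ xs) (↭-trans xs↭ys (↭-sym (sort-↭ ys)))))))
  (≡-dec ℕ._≟_ (sort xs) (sort ys))

hasCycleType? : (μ : Partition n) → Decidable (HasCycleType μ)
hasCycleType? μ π = cycleLengths π ↭? parts μ

-- A permutation of Fin (suc n) is determined by the image j of zero and
-- the permutation of Fin n obtained by deleting zero and j.

permutations : ∀ n → List (Permutation′ n)
permutations zero    = idₚ ∷ []
permutations (suc n) = cartesianProductWith (insert zero) (allFin (suc n)) (permutations n)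

permutationSetoid : ℕ → Setoid 0ℓ 0ℓ
permutationSetoid n = record
  { Carrier       = Permutation′ n
  ; _≈_           = _≈ₚ_
  ; isEquivalence = record
    { refl  = λ _ → refl
    ; sym   = λ eq i → sym (eq i)
    ; trans = λ eq₁ eq₂ i → trans (eq₁ i) (eq₂ i)
    }
  }

permutations-complete : (π : Permutation′ n) → Any (π ≈ₚ_) (permutations n)
permutations-complete {zero}  π = here λ ()
permutations-complete {suc n} π =
  Any.cartesianProductWith⁺ (insert zero) agree
    (∈-allFin (π ⟨$⟩ʳ zero)) (permutations-complete (remove zero π))
  where
  agree : ∀ {j ρ} → π ⟨$⟩ʳ zero ≡ j → remove zero π ≈ₚ ρ → π ≈ₚ insert zero j ρ
  agree refl eq zero        = refl
  agree {ρ = ρ} refl eq (Fin.suc k) =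
    trans (sym (insert-remove zero π (Fin.suc k))) (cong (Fin.punchIn _) (eq k))

permutations-unique : ∀ n → UniqueSetoid.Unique (permutationSetoid n) (permutations n)
permutations-unique zero    = [] ∷ []
permutations-unique (suc n) =
  UniqueSetoid.cartesianProductWith⁺
    (setoid (Fin (suc n))) (permutationSetoid n) (permutationSetoid (suc n))
    (insert zero) insert-injective (Unique.allFin⁺ (suc n)) (permutations-unique n)
  where
  insert-injective : ∀ {j k : Fin (suc n)} {π ρ : Permutation′ n} →
                     insert zero j π ≈ₚ insert zero k ρ → j ≡ k × π ≈ₚ ρ
  insert-injective {j} eq with refl ← eq zero =
    refl , λ i → Fin.punchIn-injective j _ _ (eq (Fin.suc i))

𝔖 : ∀ n → Partition n → List (Permutation′ n)
𝔖 n μ = filter (hasCycleType? μ) (permutations n)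

∑[s^cval·t^exc] : List (Permutation′ n) → ℤ[t][s].Carrier
∑[s^cval·t^exc] πs =
  foldr _⊕_ 0# (map (λ π → s ^ cval π ⊗ const (t ℤ[t].^ exc π)) πs)
  where
  open ℤ[t][s] renaming (_+_ to _⊕_; _*_ to _⊗_)
  open ℤ[t] using (t)

{-# OPTIONS --safe #-}
module Submission where

-- Call x a double ascent of π if π⁻¹ x < x < π x, and a double descent if
-- π⁻¹ x > x > π x. Moving a double ascent x within its cycle to the right of
-- the maximal run of larger elements following it turns x into a double
-- descent and affects no other cyclic valley, double ascent or double descent;
-- this is invertible. Let c_d be the number of permutations of cycle type μ
-- with i cyclic valleys and d double ascents, hence with exc = i + d. Such a
-- permutation has M − d double descents, where M = n − fix − 2i and fix is
-- the number of parts of μ equal to 1. Counting permutations with a marked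
-- double ascent gives (d + 1) c_{d+1} = (M − d) c_d, so c_d = c_0 (M choose d) and
-- the coefficient of sⁱ is c_0 tⁱ (1 + t)^M.

import Algebra.Definitions.RawSemiring as SemiringOps
open import Algebra.Bundles using (RawSemiring)
open import Data.Bool.Base using (if_then_else_)
open import Data.Fin.Base using (Fin; zero; suc; toℕ; fromℕ<; _<_)
open import Data.Fin.Permutation
  using (Permutation′; _⟨$⟩ʳ_; _⟨$⟩ˡ_; flip; inverseˡ; inverseʳ; transpose; _∘ₚ_)
  renaming (_≈_ to _≈ₚ_)
import Data.Fin.Permutation.Components as Components
open import Data.Fin.Properties as Fin
  using (_≟_; _<?_; <-cmp; <-irrefl; <-asym; <-trans; <⇒≢; ≤-reflexive; ≤∧≢⇒<)
open import Data.Integer.Base as ℤ using (ℤ; +_)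
import Data.Integer.Properties as ℤ
open import Data.List.Base
  using (List; []; _∷_; _++_; map; filter; length; allFin; removeAt; cartesianProduct)
open import Data.List.Membership.Propositional using (_∈_)
open import Data.List.Membership.Propositional.Properties using (∈-allFin; ∈-filter⁺)
open import Data.List.Properties
  using (length-removeAt′; length-++; length-tabulate; filter-++; filter-≐;
         filter-accept; filter-reject; map-cong)
open import Data.List.Relation.Binary.Permutation.Propositional using (_↭_)
open import Data.List.Relation.Binary.Permutation.Propositional.Properties using (↭-length; filter-↭)
open import Data.List.Relation.Unary.All as All using (All; []; _∷_)
import Data.List.Relation.Unary.All.Properties as All
open import Data.List.Relation.Unary.AllPairs as AllPairs using (AllPairs; []; _∷_)
import Data.List.Relation.Unary.AllPairs.Properties as AllPairs
open import Data.List.Relation.Unary.Any as Any using (Any; here; there; index)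
import Data.List.Relation.Unary.Any.Properties as Any
open import Data.List.Relation.Unary.Unique.Propositional using (Unique)
import Data.List.Relation.Unary.Unique.Propositional.Properties as Unique
import Data.List.Relation.Unary.Unique.Setoid.Properties as UniqueSetoid
open import Data.Nat.Base as ℕ using (ℕ; zero; suc; _+_; _*_; _∸_; ⌊_/2⌋; NonZero)
open import Data.Nat.Combinatorics using (_C_; nC1≡n; nCk+nC[k+1]≡[n+1]C[k+1])
open import Data.Nat.GeneralisedArithmetic using (fold-+)
import Data.Nat.Properties as ℕ
open import Data.Nat.Solver using (module +-*-Solver)
open import Data.Product.Base using (∃; _×_; _,_; proj₁; proj₂; swap)
open import Data.Vec.Functional using (Vector)
open import Function.Base using (_∘_; id)
open import Level using (0ℓ)
open import Relation.Binary.Bundles using (Setoid)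
open import Relation.Binary.Definitions using (Tri; tri<; tri≈; tri>)
open import Relation.Binary.PropositionalEquality as ≡
  using (_≡_; _≢_; refl; sym; trans; cong; cong₂; subst; setoid; ≢-sym; module ≡-Reasoning)
import Relation.Binary.Reasoning.Setoid as SetoidReasoning
open import Relation.Binary.Structures using (IsEquivalence)
open import Relation.Nullary using (¬_; Dec; yes; no; contradiction)
open import Relation.Nullary.Decidable using (_×-dec_; ¬?; does; dec-true; dec-false)
open import Relation.Unary using (Decidable; _≐_)
open import Defs

private
  variable
    A B : Set
    n : ℕ
    π π′ ρ : Permutation′ n
    x : Fin n

-- Counting in lists

count : {P : A → Set} → Decidable P → List A → ℕ
count P? xs = length (filter P? xs)

count-cong : {P Q : A → Set} (P? : Decidable P) (Q? : Decidable Q) → P ≐ Q →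
             ∀ xs → count P? xs ≡ count Q? xs
count-cong P? Q? P≐Q xs = cong length (filter-≐ P? Q? P≐Q xs)

count-none : {P : A → Set} (P? : Decidable P) → (∀ {x} → ¬ P x) → ∀ xs → count P? xs ≡ 0
count-none P? ¬P []       = refl
count-none P? ¬P (x ∷ xs) =
  trans (cong length (filter-reject P? ¬P)) (count-none P? ¬P xs)

count-accept : {P : A → Set} (P? : Decidable P) → ∀ {x} xs → P x →
               count P? (x ∷ xs) ≡ suc (count P? xs)
count-accept P? xs px = cong length (filter-accept P? px)

count-reject : {P : A → Set} (P? : Decidable P) → ∀ {x} xs → ¬ P x →
               count P? (x ∷ xs) ≡ count P? xs
count-reject P? xs ¬px = cong length (filter-reject P? ¬px)

count≢0⇒∃ : {P : A → Set} (P? : Decidable P) → ∀ xs → count P? xs ≢ 0 → ∃ P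
count≢0⇒∃ P? []       ≢0 = contradiction refl ≢0
count≢0⇒∃ P? (x ∷ xs) ≢0 with P? x
... | yes p = x , p
... | no  _ = count≢0⇒∃ P? xs ≢0

count-split : {P Q : A → Set} (P? : Decidable P) (Q? : Decidable Q) → ∀ xs →
              count (λ x → P? x ×-dec Q? x) xs + count (λ x → P? x ×-dec ¬? (Q? x)) xs ≡ count P? xs
count-split P? Q? []       = refl
count-split P? Q? (x ∷ xs) with P? x | Q? x
... | yes _ | yes _ = cong suc (count-split P? Q? xs)
... | yes _ | no  _ = trans (ℕ.+-suc _ _) (cong suc (count-split P? Q? xs))
... | no  _ | _     = count-split P? Q? xs

count-tri : {P Q R : A → Set} (P? : Decidable P) (Q? : Decidable Q) (R? : Decidable R) →
            (∀ x → Tri (P x) (Q x) (R x)) →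
            ∀ xs → count P? xs + count Q? xs + count R? xs ≡ length xs
count-tri P? Q? R? tri []       = refl
count-tri P? Q? R? tri (x ∷ xs) with P? x | Q? x | R? x | tri x
... | yes _ | no _  | no _  | _ = cong suc (count-tri P? Q? R? tri xs)
... | no _  | yes _ | no _  | _ =
  trans (cong (_+ count R? xs) (ℕ.+-suc (count P? xs) _)) (cong suc (count-tri P? Q? R? tri xs))
... | no _  | no _  | yes _ | _ =
  trans (ℕ.+-suc (count P? xs + _) _) (cong suc (count-tri P? Q? R? tri xs))
... | no ¬p | no ¬q | no ¬r | tri< p _ _ = contradiction p ¬p
... | no ¬p | no ¬q | no ¬r | tri≈ _ q _ = contradiction q ¬q
... | no ¬p | no ¬q | no ¬r | tri> _ _ r = contradiction r ¬r
... | yes p | yes q | _     | tri< _ ¬q _ = contradiction q ¬q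
... | yes p | yes q | _     | tri≈ ¬p _ _ = contradiction p ¬p
... | yes p | yes q | _     | tri> ¬p _ _ = contradiction p ¬p
... | yes p | no _  | yes r | tri< _ _ ¬r = contradiction r ¬r
... | yes p | no _  | yes r | tri≈ ¬p _ _ = contradiction p ¬p
... | yes p | no _  | yes r | tri> ¬p _ _ = contradiction p ¬p
... | no _  | yes q | yes r | tri< _ ¬q _ = contradiction q ¬q
... | no _  | yes q | yes r | tri≈ _ _ ¬r = contradiction r ¬r
... | no _  | yes q | yes r | tri> _ ¬q _ = contradiction q ¬q

count-++ : {P : A → Set} (P? : Decidable P) → ∀ xs ys →
           count P? (xs ++ ys) ≡ count P? xs + count P? ys
count-++ P? xs ys = trans (cong length (filter-++ P? xs ys)) (length-++ (filter P? xs))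

count-map : {P : B → Set} (P? : Decidable P) (f : A → B) →
            ∀ xs → count P? (map f xs) ≡ count (P? ∘ f) xs
count-map P? f []       = refl
count-map P? f (x ∷ xs) with P? (f x)
... | yes _ = cong suc (count-map P? f xs)
... | no  _ = count-map P? f xs

count-filter : {P Q : A → Set} (P? : Decidable P) (Q? : Decidable Q) → ∀ xs →
               count P? (filter Q? xs) ≡ count (λ x → Q? x ×-dec P? x) xs
count-filter P? Q? []       = refl
count-filter P? Q? (x ∷ xs) with Q? x
... | no  _ = count-filter P? Q? xs
... | yes _ with P? x
...   | yes _ = cong suc (count-filter P? Q? xs)
...   | no  _ = count-filter P? Q? xs

-- Double counting: over a good `x` the row of the product contributes `q`, over any other `x`
-- nothing. This turns a count of permutations with a marked point into a class size times a number
-- of points.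
count-product :
  {P : A → Set} {Q : A → B → Set} (P? : Decidable P) (Q? : ∀ x → Decidable (Q x))
  (ys : List B) (q : ℕ) →
  (∀ {x} → P x → count (Q? x) ys ≡ q) → ∀ xs →
  count (λ (x , y) → P? x ×-dec Q? x y) (cartesianProduct xs ys) ≡ count P? xs * q
count-product P? Q? ys q rows []       = refl
count-product {A = A} {B = B} {P = P} {Q = Q} P? Q? ys q rows (x ∷ xs) =
  trans (count-++ PQ? (map (x ,_) ys) _)
        (trans (cong₂ _+_ (count-map PQ? (x ,_) ys) (count-product P? Q? ys q rows xs)) row)
  where
  PQ? : Decidable {A = A × B} (λ (x , y) → P x × Q x y)
  PQ? (x , y) = P? x ×-dec Q? x y

  row : count (PQ? ∘ (x ,_)) ys + count P? xs * q ≡ count P? (x ∷ xs) * q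
  row with P? x
  ... | yes p = cong (_+ _) (trans (count-cong _ (Q? x) (proj₂ , (p ,_)) ys) (rows p))
  ... | no ¬p = cong (_+ _) (count-none _ (¬p ∘ proj₁) ys)

-- The deleted entry satisfies `P`, which excludes `Q`, so the witness of `Q` is another entry and
-- survives.
Any-removeAt : {P Q : A → Set} {xs : List A} (p : Any P xs) → Any Q xs →
               (∀ {x} → P x → ¬ Q x) → Any Q (removeAt xs (index p))
Any-removeAt {xs = x ∷ _}     (here px) (here qx) P#Q = contradiction qx (P#Q px)
Any-removeAt {xs = x ∷ _}     (here px) (there q) P#Q = q
Any-removeAt {xs = x ∷ _ ∷ _} (there p) (here qx) P#Q = here qx
Any-removeAt {xs = x ∷ _ ∷ _} (there p) (there q) P#Q = there (Any-removeAt p q P#Q)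

Any-filter : {P Q : A → Set} {xs : List A} (Q? : Decidable Q) →
             (∀ {x} → P x → Q x) → Any P xs → Any P (filter Q? xs)
Any-filter {xs = x ∷ xs} Q? P⊆Q (here px) rewrite filter-accept Q? {xs = xs} (P⊆Q px) = here px
Any-filter {xs = x ∷ _} Q? P⊆Q (there p) with Q? x
... | yes _ = there (Any-filter Q? P⊆Q p)
... | no  _ = Any-filter Q? P⊆Q p

-- Pigeonhole by matching: the partner of the first element is deleted from `ys`, and the later
-- elements keep theirs, since no `y` is related to two entries of `xs`.
length-≤ : {xs : List A} {ys : List B} {R : A → B → Set} →
           AllPairs (λ x x′ → ∀ y → R x y → ¬ R x′ y) xs →
           All (λ x → Any (R x) ys) xs → length xs ℕ.≤ length ys
length-≤ []             []       = ℕ.z≤n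
length-≤ {ys = ys} (x# ∷ #s) (p ∷ ps) =
  subst (_ ℕ.≤_) (sym (length-removeAt′ ys (index p)))
    (ℕ.s≤s (length-≤ #s (All.zipWith (λ (# , q) → Any-removeAt p q (# _)) (x# , ps))))

count-≤ : {P : A → Set} {Q : B → Set} {xs : List A} {ys : List B}
          {R : A → B → Set} {_≈_ : A → A → Set} (P? : Decidable P) (Q? : Decidable Q) →
          AllPairs (λ x x′ → ¬ x ≈ x′) xs →
          (∀ {x x′ y} → R x y → R x′ y → x ≈ x′) →
          (∀ {x} → P x → Any (R x) ys) →
          (∀ {x y} → P x → R x y → Q y) →
          count P? xs ℕ.≤ count Q? ys
count-≤ {xs = xs} P? Q? unique injective total P⇒Q =
  length-≤ (AllPairs.filter⁺ P? (AllPairs.map (λ x≉ _ r r′ → x≉ (injective r r′)) unique))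
           (All.map (λ p → Any-filter Q? (P⇒Q p) (total p)) (All.all-filter P? xs))

-- A relation replaces a bijection because `permutations n` contains each permutation only up to
-- pointwise equality, so the image under a map need not occur in the list literally.
count-≡ : {P : A → Set} {Q : B → Set} {xs : List A} {ys : List B}
          {R : A → B → Set} {_≈₁_ : A → A → Set} {_≈₂_ : B → B → Set}
          (P? : Decidable P) (Q? : Decidable Q) →
          AllPairs (λ x x′ → ¬ x ≈₁ x′) xs → AllPairs (λ y y′ → ¬ y ≈₂ y′) ys →
          (∀ {x x′ y} → R x y → R x′ y → x ≈₁ x′) →
          (∀ {x y y′} → R x y → R x y′ → y ≈₂ y′) →
          (∀ {x} → P x → Any (R x) ys) → (∀ {y} → Q y → Any (λ x → R x y) xs) →
          (∀ {x y} → P x → R x y → Q y) → (∀ {x y} → Q y → R x y → P x) →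
          count P? xs ≡ count Q? ys
count-≡ P? Q? unique₁ unique₂ injective functional total surjective P⇒Q Q⇒P =
  ℕ.≤-antisym (count-≤ P? Q? unique₁ injective total P⇒Q)
              (count-≤ Q? P? unique₂ functional surjective Q⇒P)

-- Cycles and hops

⟨$⟩ˡ-unique : (π : Permutation′ n) → ∀ {i j} → π ⟨$⟩ʳ i ≡ j → π ⟨$⟩ˡ j ≡ i
⟨$⟩ˡ-unique π refl = inverseˡ π

⟨$⟩ʳ-injective : (π : Permutation′ n) → ∀ {i j} → π ⟨$⟩ʳ i ≡ π ⟨$⟩ʳ j → i ≡ j
⟨$⟩ʳ-injective π eq = trans (sym (⟨$⟩ˡ-unique π eq)) (inverseˡ π)

≈ₚ-flip : (π ρ : Permutation′ n) → flip π ≈ₚ flip ρ → π ≈ₚ ρ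
≈ₚ-flip π ρ eq i = ⟨$⟩ˡ-unique (flip π) (trans (eq _) (inverseˡ ρ))

SameCycle-step : ∀ i → SameCycle π i (π ⟨$⟩ʳ i)
SameCycle-step i = 1 , refl

SameCycle-trans : ∀ {i j k} → SameCycle π i j → SameCycle π j k → SameCycle π i k
SameCycle-trans {π = π} {i = i} (p , refl) (q , refl) = q + p , fold-+ i (π ⟨$⟩ʳ_) q

SameCycle-sym : ∀ {i j} → SameCycle π i j → SameCycle π j i
SameCycle-sym {π = π} {i = i} (k , refl) with p , p≢0 , _ , eq ← period π i =
  -- `k * p` steps are `k` returns to `i`; those remaining after the first `k` lead from `j` to `i`.
  -- As `p` is nonzero, `k` is at most `k * p`.
  k * p ∸ k , trans (sym (fold-+ i (π ⟨$⟩ʳ_) (k * p ∸ k)))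
             (trans (cong (π ^_· i) (ℕ.m∸n+n≡m (ℕ.m≤m*n k p {{p≢0}}))) (^-multiple π k p eq))

-- By induction on the number of steps, only single steps of `ρ` have to be traced inside the cycles
-- of `π`.
SameCycle-⊆ : (∀ i → SameCycle π i (ρ ⟨$⟩ʳ i)) → ∀ {i j} → SameCycle ρ i j → SameCycle π i j
SameCycle-⊆                 steps (zero  , refl) = 0 , refl
SameCycle-⊆ {π = π} {ρ = ρ} steps (suc k , refl) =
  SameCycle-trans {π = π} (SameCycle-⊆ {π = π} {ρ = ρ} steps (k , refl)) (steps _)

SameCycle-flip : ∀ {i j} → SameCycle (flip π) i j → SameCycle π i j
SameCycle-flip {π = π} = SameCycle-⊆ {π = π} {ρ = flip π}
  λ i → SameCycle-sym {π = π} (1 , inverseʳ π)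

-- A stretch of an orbit, both ends included, that stays above `x`. Maximality is not built in: it
-- is expressed by the separate condition `f v < x`.
data Path (f : Fin n → Fin n) (x : Fin n) : Fin n → Fin n → Set where
  [_] : ∀ {u} → x < u → Path f x u u
  _∷_ : ∀ {u v} → x < u → Path f x (f u) v → Path f x u v

module _ {f : Fin n → Fin n} where

  source-above : ∀ {u v} → Path f x u v → x < u
  source-above [ x<u ]   = x<u
  source-above (x<u ∷ _) = x<u

  target-above : ∀ {u v} → Path f x u v → x < v
  target-above [ x<u ]   = x<u
  target-above (_ ∷ p) = target-above p

  snoc : ∀ {u v} → Path f x u v → x < f v → Path f x u (f v)
  snoc [ x<u ]   x<fv = x<u ∷ [ x<fv ]
  snoc (x<u ∷ p) x<fv = x<u ∷ snoc p x<fv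

-- Inversion is demanded only where both `u` and `f u` lie above `x`, as they do on steps inside a
-- run. A hop provides no more, since it redirects the arrows entering and leaving the run.
reverse : {f g : Fin n → Fin n} → (∀ {u} → x < u → x < f u → g (f u) ≡ u) →
          ∀ {u v} → Path f x u v → Path g x v u
reverse gf [ x<u ]   = [ x<u ]
reverse {x = x} {g = g} gf {v = v} (x<u ∷ p) =
  subst (Path g x v) eq (snoc (reverse gf p) (subst (x <_) (sym eq) x<u))
  where eq = gf x<u (source-above p)

-- If one path continued past the end of the other, it would pass through a point below `x`; so both
-- stop just before the first fall.
target-unique : {f : Fin n → Fin n} → ∀ {u v w} →
                Path f x u v → Path f x u w → f v < x → f w < x → v ≡ w
target-unique [ _ ]   [ _ ]   v↓ w↓ = refl
target-unique [ _ ]   (_ ∷ q) v↓ w↓ = contradiction (source-above q) (<-asym v↓)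
target-unique (_ ∷ p) [ _ ]   v↓ w↓ = contradiction (source-above p) (<-asym w↓)
target-unique (_ ∷ p) (_ ∷ q) v↓ w↓ = target-unique p q v↓ w↓

Path⇒SameCycle : ∀ {u v} → Path (π ⟨$⟩ʳ_) x u v → SameCycle π u v
Path⇒SameCycle         [ _ ]           = 0 , refl
Path⇒SameCycle {π = π} (_∷_ {u = u} _ p) =
  SameCycle-trans {π = π} (SameCycle-step {π = π} u) (Path⇒SameCycle {π = π} p)

-- The cycle of π through a, x, π x, …, y, π y becomes that of π′ through
-- a, π x, …, y, x, π y: x hops over the maximal run of larger elements after it.

record Hop (x : Fin n) (π π′ : Permutation′ n) : Set where
  field
    a y       : Fin n
    πa≡x      : π ⟨$⟩ʳ a ≡ x
    run       : Path (π ⟨$⟩ʳ_) x (π ⟨$⟩ʳ x) y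
    a<x       : a < x
    πy<x      : π ⟨$⟩ʳ y < x
    π′a≡πx    : π′ ⟨$⟩ʳ a ≡ π ⟨$⟩ʳ x
    π′y≡x     : π′ ⟨$⟩ʳ y ≡ x
    π′x≡πy    : π′ ⟨$⟩ʳ x ≡ π ⟨$⟩ʳ y
    elsewhere : ∀ {u} → u ≢ a → u ≢ x → u ≢ y → π′ ⟨$⟩ʳ u ≡ π ⟨$⟩ʳ u

  x<πx : x < π ⟨$⟩ʳ x
  x<πx = source-above run

  x<y : x < y
  x<y = target-above run

-- The cycle of the inverse of `π′` reads `π y`, `x`, `y`, ..., `π x`, `a`. Hopping `x` over this
-- reversed run gives the inverse of `π`, so a hop is undone by a hop of inverses.
Hop-flip : Hop x π π′ → Hop x (flip π′) (flip π)
Hop-flip {x = x} {π = π} {π′ = π′} hop = record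
  { a         = π ⟨$⟩ʳ y
  ; y         = π ⟨$⟩ʳ x
  ; πa≡x      = ⟨$⟩ˡ-unique π′ π′x≡πy
  ; run       = subst (λ u → Path (π′ ⟨$⟩ˡ_) x u (π ⟨$⟩ʳ x)) (sym π′⁻¹x≡y) (reverse undo run)
  ; a<x       = πy<x
  ; πy<x      = subst (_< x) (sym π′⁻¹πx≡a) a<x
  ; π′a≡πx    = trans (inverseˡ π) (sym π′⁻¹x≡y)
  ; π′y≡x     = inverseˡ π
  ; π′x≡πy    = trans (⟨$⟩ˡ-unique π πa≡x) (sym π′⁻¹πx≡a)
  ; elsewhere = λ {u} u≢πy u≢x u≢πx → sym (⟨$⟩ˡ-unique π′ (trans
      (elsewhere (λ eq → u≢x  (trans (sym (inverseʳ π)) (trans (cong (π ⟨$⟩ʳ_) eq) πa≡x)))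
                 (λ eq → u≢πx (trans (sym (inverseʳ π)) (cong (π ⟨$⟩ʳ_) eq)))
                 (λ eq → u≢πy (trans (sym (inverseʳ π)) (cong (π ⟨$⟩ʳ_) eq))))
      (inverseʳ π)))
  }
  where
  open Hop hop
  π′⁻¹x≡y : π′ ⟨$⟩ˡ x ≡ y
  π′⁻¹x≡y = ⟨$⟩ˡ-unique π′ π′y≡x

  π′⁻¹πx≡a : π′ ⟨$⟩ˡ (π ⟨$⟩ʳ x) ≡ a
  π′⁻¹πx≡a = ⟨$⟩ˡ-unique π′ π′a≡πx

  undo : ∀ {u} → x < u → x < π ⟨$⟩ʳ u → π′ ⟨$⟩ˡ (π ⟨$⟩ʳ u) ≡ u
  -- A step inside the run starts above `x`, hence at neither `a` nor `x`, and ends above `x`, hence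
  -- does not start at `y`; there `π′` agrees with `π`.
  undo x<u x<πu = ⟨$⟩ˡ-unique π′ (elsewhere
    (λ { refl → <-asym x<u a<x }) (λ { refl → <-irrefl refl x<u }) (λ { refl → <-asym x<πu πy<x }))

-- `a` is the preimage of `x` and `y` is the end of the maximal run, so `π` and `x` determine both,
-- and these fix `π′` everywhere.
Hop-functional : Hop x π π′ → Hop x π ρ → π′ ≈ₚ ρ
Hop-functional {x = x} {π = π} hop hop′ i
  with refl ← ⟨$⟩ʳ-injective π (trans (Hop.πa≡x hop) (sym (Hop.πa≡x hop′)))
     | refl ← target-unique (Hop.run hop) (Hop.run hop′) (Hop.πy<x hop) (Hop.πy<x hop′)
  with i ≟ Hop.a hop | i ≟ x | i ≟ Hop.y hop
... | yes refl | _        | _        = trans (Hop.π′a≡πx hop) (sym (Hop.π′a≡πx hop′))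
... | no _     | yes refl | _        = trans (Hop.π′x≡πy hop) (sym (Hop.π′x≡πy hop′))
... | no _     | no _     | yes refl = trans (Hop.π′y≡x hop) (sym (Hop.π′y≡x hop′))
... | no i≢a   | no i≢x   | no i≢y   =
  trans (Hop.elsewhere hop i≢a i≢x i≢y) (sym (Hop.elsewhere hop′ i≢a i≢x i≢y))

Hop-injective : Hop x π π′ → Hop x ρ π′ → π ≈ₚ ρ
Hop-injective {π = π} {ρ = ρ} hop hop′ = ≈ₚ-flip π ρ (Hop-functional (Hop-flip hop) (Hop-flip hop′))

Hop-respʳ : π′ ≈ₚ ρ → Hop x π π′ → Hop x π ρ
Hop-respʳ eq hop = record
  { a = a ; y = y ; πa≡x = πa≡x ; run = run ; a<x = a<x ; πy<x = πy<x
  ; π′a≡πx    = trans (sym (eq a)) π′a≡πx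
  ; π′y≡x     = trans (sym (eq y)) π′y≡x
  ; π′x≡πy    = trans (sym (eq _)) π′x≡πy
  ; elsewhere = λ u≢a u≢x u≢y → trans (sym (eq _)) (elsewhere u≢a u≢x u≢y)
  }
  where open Hop hop

transpose-matchˡ : (i j : Fin n) → Components.transpose i j i ≡ j
transpose-matchˡ i j rewrite dec-true (i ≟ i) refl = refl

transpose-matchʳ : (i j : Fin n) → Components.transpose i j j ≡ i
transpose-matchʳ i j with j ≟ i
... | yes j≡i = j≡i
... | no  _   rewrite dec-true (j ≟ j) refl = refl

transpose-mismatch : {i j k : Fin n} → k ≢ i → k ≢ j → Components.transpose i j k ≡ k
transpose-mismatch {i = i} {j} {k} k≢i k≢j
  rewrite dec-false (k ≟ i) k≢i | dec-false (k ≟ j) k≢j = refl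

^-suc : (π : Permutation′ n) → ∀ k {u} → π ^ suc k · u ≡ π ^ k · (π ⟨$⟩ʳ u)
^-suc π k {u} = trans (cong (π ^_· u) (ℕ.+-comm 1 k)) (fold-+ u (π ⟨$⟩ʳ_) k)

-- The orbit of `u` is followed until it first falls below `x`; the `k` steps known to lead below
-- `x` bound the search.
descent : (π : Permutation′ n) → π ⟨$⟩ˡ x < x → ∀ k {u} → x < u → π ^ k · u < x →
          ∃ λ y → Path (π ⟨$⟩ʳ_) x u y × π ⟨$⟩ʳ y < x
descent         π π⁻¹x<x zero        x<u u<x = contradiction u<x (<-asym x<u)
descent {x = x} π π⁻¹x<x (suc k) {u} x<u πᵏ⁺¹u<x with <-cmp (π ⟨$⟩ʳ u) x
... | tri< πu<x _ _ = u , [ x<u ] , πu<x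
-- The orbit cannot land on `x` itself: `x` is entered only from its preimage, which is below `x`,
-- while `u` is above.
... | tri≈ _ πu≡x _ = contradiction (subst (_< x) (⟨$⟩ˡ-unique π πu≡x) π⁻¹x<x) (<-asym x<u)
... | tri> _ _ x<πu
  with y , run , πy<x ← descent π π⁻¹x<x k x<πu (subst (_< x) (^-suc π k) πᵏ⁺¹u<x)
  = y , x<u ∷ run , πy<x
Hop-exists : (π : Permutation′ n) → π ⟨$⟩ˡ x < x → x < π ⟨$⟩ʳ x → ∃ (Hop x π)
Hop-exists {x = x} π a<x x<πx
  -- Going round the cycle, some `k` steps lead from `π x` to `a`, which is below `x`; this starts
  -- `descent`.
  with k , πᵏπx≡a ← SameCycle-trans {π = π} (SameCycle-sym {π = π} (SameCycle-step {π = π} x))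
                      (SameCycle-sym {π = π} (1 , inverseʳ π))
  with y , run , πy<x ← descent π a<x k x<πx (subst (_< x) (sym πᵏπx≡a) a<x) =
  -- Swapping `a` with `x`, then `a` with `y`, and then applying `π` sends `a`, `x`, `y` to `π x`,
  -- `π y`, `π a`, and `π a` is `x`.
  (transpose a x ∘ₚ transpose a y) ∘ₚ π , record
    { a         = a
    ; y         = y
    ; πa≡x      = inverseʳ π
    ; run       = run
    ; a<x       = a<x
    ; πy<x      = πy<x
    ; π′a≡πx    = cong (π ⟨$⟩ʳ_) (trans (cong (Components.transpose a y) (transpose-matchˡ a x))
                    (transpose-mismatch (≢-sym (<⇒≢ a<x)) (<⇒≢ (target-above run))))
    ; π′y≡x     = trans
        (cong (π ⟨$⟩ʳ_) (trans
          (cong (Components.transpose a y) (transpose-mismatch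
            (≢-sym (<⇒≢ (<-trans a<x (target-above run)))) (≢-sym (<⇒≢ (target-above run)))))
          (transpose-matchʳ a y)))
        (inverseʳ π)
    ; π′x≡πy    = cong (π ⟨$⟩ʳ_)
                    (trans (cong (Components.transpose a y) (transpose-matchʳ a x)) (transpose-matchˡ a y))
    ; elsewhere = λ u≢a u≢x u≢y → cong (π ⟨$⟩ʳ_)
                    (trans (cong (Components.transpose a y) (transpose-mismatch u≢a u≢x))
                           (transpose-mismatch u≢a u≢y))
    }
  where
  a = π ⟨$⟩ˡ x

-- The three redirected arrows stay inside the cycle of `x`, which contains `a` and the whole run.
-- The converse inclusion comes from the inverse hop.
Hop-SameCycle : Hop x π π′ → ∀ {i j} → SameCycle π′ i j → SameCycle π i j
Hop-SameCycle {x = x} {π = π} {π′ = π′} hop = SameCycle-⊆ {π = π} {ρ = π′} steps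
  where
  open Hop hop
  x∼y : SameCycle π x y
  x∼y = SameCycle-trans {π = π} (SameCycle-step {π = π} x) (Path⇒SameCycle {π = π} run)

  steps : ∀ i → SameCycle π i (π′ ⟨$⟩ʳ i)
  steps i with i ≟ a | i ≟ x | i ≟ y
  ... | yes refl | _        | _        = 2 , trans (cong (π ⟨$⟩ʳ_) πa≡x) (sym π′a≡πx)
  ... | no _     | yes refl | _        = subst (SameCycle π x) (sym π′x≡πy)
                                           (SameCycle-trans {π = π} x∼y (SameCycle-step {π = π} y))
  ... | no _     | no _     | yes refl = subst (SameCycle π y) (sym π′y≡x) (SameCycle-sym {π = π} x∼y)
  ... | no i≢a   | no i≢x   | no i≢y   = 1 , sym (elsewhere i≢a i≢x i≢y)

Hop-SameCycle⁻¹ : Hop x π π′ → ∀ {i j} → SameCycle π i j → SameCycle π′ i j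
Hop-SameCycle⁻¹ {π = π} {π′ = π′} hop =
  SameCycle-flip {π = π′} ∘ Hop-SameCycle (Hop-flip hop) ∘ SameCycle-flip {π = flip π}

-- Away from `x` only the images of `a` and `y` change. Both images of `a`, namely `x` and `π x`,
-- exceed `a`; both images of `y`, namely `π y` and `x`, are below `y`.
Hop-excedance : Hop x π π′ → ∀ {i} → i ≢ x → IsExcedance π i → IsExcedance π′ i
Hop-excedance {x = x} {π = π} {π′ = π′} hop {i} i≢x i<πi with i ≟ Hop.a hop | i ≟ Hop.y hop
... | yes refl | _        = subst (i <_) (sym (Hop.π′a≡πx hop)) (<-trans (Hop.a<x hop) (Hop.x<πx hop))
... | no _     | yes refl = contradiction (<-trans i<πi (Hop.πy<x hop)) (<-asym (Hop.x<y hop))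
... | no i≢a   | no i≢y   = subst (i <_) (sym (Hop.elsewhere hop i≢a i≢x i≢y)) i<πi

Hop-excedance⁻¹ : Hop x π π′ → ∀ {i} → i ≢ x → IsExcedance π′ i → IsExcedance π i
Hop-excedance⁻¹ {x = x} {π = π} {π′ = π′} hop {i} i≢x i<π′i with i ≟ Hop.a hop | i ≟ Hop.y hop
... | yes refl | _        = subst (i <_) (sym (Hop.πa≡x hop)) (Hop.a<x hop)
... | no _     | yes refl = contradiction (subst (i <_) (Hop.π′y≡x hop) i<π′i) (<-asym (Hop.x<y hop))
... | no i≢a   | no i≢y   = subst (i <_) (Hop.elsewhere hop i≢a i≢x i≢y) i<π′i

-- Statistics of permutations

length-allFin : ∀ n → length (allFin n) ≡ n
length-allFin n = length-tabulate {n = n} id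

module _ {P : Fin n → Set} (P? : Decidable P) where

  count-singleton : P x → (∀ {i} → P i → i ≡ x) → count P? (allFin n) ≡ 1
  count-singleton {x = x} px P⇒≡ =
    one (Unique.filter⁺ P? (Unique.allFin⁺ n)) (All.map P⇒≡ (All.all-filter P? (allFin n)))
        (∈-filter⁺ P? (∈-allFin x) px)
    where
    one : ∀ {xs} → Unique xs → All (_≡ x) xs → x ∈ xs → length xs ≡ 1
    one {_ ∷ []}    _                 _                   _ = refl
    one {_ ∷ _ ∷ _} ((y≢z ∷ _) ∷ _) (refl ∷ refl ∷ _) _ = contradiction refl y≢z

  count≡1⇒≡ : count P? (allFin n) ≡ 1 → ∀ {i j} → P i → P j → i ≡ j
  count≡1⇒≡ eq {i} {j} pi pj =
    same eq (∈-filter⁺ P? (∈-allFin i) pi) (∈-filter⁺ P? (∈-allFin j) pj)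
    where
    same : ∀ {xs} → length xs ≡ 1 → i ∈ xs → j ∈ xs → i ≡ j
    same {_ ∷ []} _ (here refl) (here refl) = refl

isFixed? : (π : Permutation′ n) → Decidable (λ i → π ⟨$⟩ʳ i ≡ i)
isFixed? π i = π ⟨$⟩ʳ i ≟ i

fixed : Permutation′ n → ℕ
fixed π = count (isFixed? π) (allFin _)

-- The negated half allows the preimage of `i` to equal `i`, but an excedance is not fixed, so the
-- inequality is strict. Double descents of `π` are expressed as double ascents of `flip π`.
IsDoubleAscent : Permutation′ n → Fin n → Set
IsDoubleAscent π i = IsExcedance π i × ¬ IsExcedance (flip π) i

isDoubleAscent? : (π : Permutation′ n) → Decidable (IsDoubleAscent π)
isDoubleAscent? π i = isExcedance? π i ×-dec ¬? (isExcedance? (flip π) i)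

doubleAscents : Permutation′ n → ℕ
doubleAscents π = count (isDoubleAscent? π) (allFin _)

cval-flip : (π : Permutation′ n) → cval (flip π) ≡ cval π
cval-flip π = count-cong (isCyclicValley? (flip π)) (isCyclicValley? π) (swap , swap) (allFin _)

exc-split : (π : Permutation′ n) → cval π + doubleAscents π ≡ exc π
-- An excedance is split by whether its preimage exceeds it. `count-split` yields the valley
-- conditions in the order they have for `flip π`, hence `cval-flip`.
exc-split π = trans (cong (_+ doubleAscents π) (sym (cval-flip π)))
                    (count-split (isExcedance? π) (isExcedance? (flip π)) (allFin _))

-- `π` itself carries the points that it lowers onto the excedances of its inverse.
anti-excedances : (π : Permutation′ n) → count (λ i → π ⟨$⟩ʳ i <? i) (allFin n) ≡ exc (flip π)
anti-excedances {n = n} π = count-≡ {R = λ i j → π ⟨$⟩ʳ i ≡ j} _ (isExcedance? (flip π))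
  (Unique.allFin⁺ n) (Unique.allFin⁺ n)
  (λ eq eq′ → ⟨$⟩ʳ-injective π (trans eq (sym eq′))) (λ eq eq′ → trans (sym eq) eq′)
  (λ {i} _ → ∈-allFin (π ⟨$⟩ʳ i))
  (λ {j} _ → Any.map (λ { refl → inverseʳ π }) (∈-allFin (π ⟨$⟩ˡ j)))
  (λ { πi<i refl → subst (_ <_) (sym (inverseˡ π)) πi<i })
  (λ { πi<i refl → subst (_ <_) (inverseˡ π) πi<i })

exc+exc+fixed : (π : Permutation′ n) → exc π + exc (flip π) + fixed π ≡ n
exc+exc+fixed {n = n} π = trans
  (cong (λ e → exc π + e + fixed π) (sym (anti-excedances π)))
  (trans (count-tri (isExcedance? π) (λ i → π ⟨$⟩ʳ i <? i) (isFixed? π) cmp (allFin n)) (length-allFin n))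
  where
  cmp : ∀ i → Tri (i < π ⟨$⟩ʳ i) (π ⟨$⟩ʳ i < i) (π ⟨$⟩ʳ i ≡ i)
  cmp i with <-cmp i (π ⟨$⟩ʳ i)
  ... | tri< a ¬b ¬c = tri< a ¬c (¬b ∘ sym)
  ... | tri≈ ¬a b ¬c = tri> ¬a ¬c (sym b)
  ... | tri> ¬a ¬b c = tri≈ ¬a c (¬b ∘ sym)

fixed⇒SameCycle⇒≡ : ∀ {i j} → π ⟨$⟩ʳ i ≡ i → SameCycle π i j → j ≡ i
fixed⇒SameCycle⇒≡         πi≡i (zero  , refl) = refl
fixed⇒SameCycle⇒≡ {π = π} πi≡i (suc k , refl) =
  trans (cong (π ⟨$⟩ʳ_) (fixed⇒SameCycle⇒≡ {π = π} πi≡i (k , refl))) πi≡i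

-- A fixed point is the minimum of its one-element cycle. Conversely, a cycle of length 1 contains
-- both `i` and `π i`, which forces them to be equal.
cycleLengths-ones : (π : Permutation′ n) → count (ℕ._≟ 1) (cycleLengths π) ≡ fixed π
cycleLengths-ones {n = n} π = trans
  (count-map (ℕ._≟ 1) (cycleLength π) (filter (isCycleMinimum? π) (allFin n)))
  (trans (count-filter (λ i → cycleLength π i ℕ.≟ 1) (isCycleMinimum? π) (allFin n))
  (count-cong _ (isFixed? π)
    ( (λ {i} (_ , eq) → count≡1⇒≡ (sameCycle? π i) eq (1 , refl) (0 , refl))
    , (λ {i} πi≡i →
        (λ j i∼j → ≤-reflexive (sym (fixed⇒SameCycle⇒≡ {π = π} πi≡i i∼j)))
      , count-singleton (sameCycle? π i) (0 , refl) (fixed⇒SameCycle⇒≡ {π = π} πi≡i)))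
    (allFin n)))

HasCycleType⇒fixed : (μ : Partition n) → HasCycleType μ π → fixed π ≡ count (ℕ._≟ 1) (parts μ)
HasCycleType⇒fixed {π = π} μ μ∼π =
  trans (sym (cycleLengths-ones π)) (↭-length (filter-↭ (ℕ._≟ 1) μ∼π))

cycleLengths-cong : (∀ {i j} → SameCycle π i j → SameCycle ρ i j) →
                    (∀ {i j} → SameCycle ρ i j → SameCycle π i j) →
                    cycleLengths π ≡ cycleLengths ρ
cycleLengths-cong {π = π} {ρ = ρ} π⊆ρ ρ⊆π =
  trans (map-cong (λ i → count-cong (sameCycle? π i) (sameCycle? ρ i) (π⊆ρ , ρ⊆π) (allFin _)) _)
        (cong (map (cycleLength ρ))
          (filter-≐ (isCycleMinimum? π) (isCycleMinimum? ρ)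
            ((λ min j → min j ∘ ρ⊆π) , (λ min j → min j ∘ π⊆ρ)) (allFin _)))

module _ {x : Fin n} {π π′ : Permutation′ n} (hop : Hop x π π′) where

  open Hop hop

  Hop-cycleLengths : cycleLengths π ≡ cycleLengths π′
  Hop-cycleLengths = cycleLengths-cong (Hop-SameCycle⁻¹ hop) (Hop-SameCycle hop)

  Hop-doubleAscent : IsDoubleAscent π x
  Hop-doubleAscent = x<πx , λ x<π⁻¹x → <-asym a<x (subst (x <_) (⟨$⟩ˡ-unique π πa≡x) x<π⁻¹x)

  Hop-doubleDescent : IsDoubleAscent (flip π′) x
  Hop-doubleDescent = subst (x <_) (sym (⟨$⟩ˡ-unique π′ π′y≡x)) x<y
                    , λ x<π′x → <-asym πy<x (subst (x <_) π′x≡πy x<π′x)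

  -- `x` is a cyclic valley of neither permutation, being a double ascent of `π` and a double
  -- descent of `π′`. Elsewhere the hop preserves excedances, both of the permutations and of their
  -- inverses.
  Hop-cval : cval π ≡ cval π′
  Hop-cval = count-cong (isCyclicValley? π) (isCyclicValley? π′)
    ( (λ {i} (v , e) → let i≢x = λ { refl → proj₂ Hop-doubleAscent v } in
        Hop-excedance⁻¹ (Hop-flip hop) i≢x v , Hop-excedance hop i≢x e)
    , (λ {i} (v , e) → let i≢x = λ { refl → proj₂ Hop-doubleDescent e } in
        Hop-excedance (Hop-flip hop) i≢x v , Hop-excedance⁻¹ hop i≢x e))
    (allFin n)

  -- Only `x` matters: it is an excedance of `π` and not of `π′`.
  Hop-exc : exc π ≡ suc (exc π′)
  Hop-exc = begin
    exc π
      ≡⟨ sym (count-split (isExcedance? π) (_≟ x) (allFin n)) ⟩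
    count (λ i → isExcedance? π i ×-dec i ≟ x) (allFin n) + others π
      ≡⟨ cong (_+ others π) (count-singleton (λ i → isExcedance? π i ×-dec i ≟ x) (x<πx , refl) proj₂) ⟩
    suc (others π)
      ≡⟨ cong suc (count-cong _ _
           ( (λ (e , i≢x) → Hop-excedance   hop i≢x e , i≢x)
           , (λ (e , i≢x) → Hop-excedance⁻¹ hop i≢x e , i≢x)) (allFin n)) ⟩
    suc (others π′)
      ≡⟨ cong (λ k → suc (k + others π′))
           (sym (count-none _ (λ { (e , refl) → proj₂ Hop-doubleDescent e }) (allFin n))) ⟩
    suc (count (λ i → isExcedance? π′ i ×-dec i ≟ x) (allFin n) + others π′)
      ≡⟨ cong suc (count-split (isExcedance? π′) (_≟ x) (allFin n)) ⟩
    suc (exc π′) ∎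
    where
    open ≡-Reasoning
    others : Permutation′ n → ℕ
    others ρ = count (λ i → isExcedance? ρ i ×-dec ¬? (i ≟ x)) (allFin n)

IsDoubleAscent⇒Hop : IsDoubleAscent π x → ∃ (Hop x π)
IsDoubleAscent⇒Hop {π = π} {x = x} (x<πx , x≮π⁻¹x) = Hop-exists π (≤∧≢⇒< (ℕ.≮⇒≥ x≮π⁻¹x) π⁻¹x≢x) x<πx
  where
  π⁻¹x≢x : π ⟨$⟩ˡ x ≢ x
  π⁻¹x≢x eq = <⇒≢ x<πx (sym (⟨$⟩ˡ-unique (flip π) eq))

-- Counting permutations by cycle type, cyclic valleys and excedances

module _ (n : ℕ) (μ : Partition n) (v : ℕ) where

  InClass : ℕ → Permutation′ n → Set
  InClass e π = HasCycleType μ π × cval π ≡ v × exc π ≡ e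

  inClass? : ∀ e → Decidable (InClass e)
  inClass? e π = hasCycleType? μ π ×-dec cval π ℕ.≟ v ×-dec exc π ℕ.≟ e

  -- At `v + d` this is c_d, since exactly `d` of the excedances are then double ascents.
  classSize : ℕ → ℕ
  classSize e = count (inClass? e) (permutations n)

  -- The number of non-fixed points of any permutation of cycle type `μ`; subtracting `2 * v` gives
  -- M.
  unfixed : ℕ
  unfixed = n ∸ count (ℕ._≟ 1) (parts μ)

  class-doubleAscents : ∀ d → InClass (v + d) π → doubleAscents π ≡ d
  class-doubleAscents {π = π} d (_ , cval≡v , exc≡v+d) =
    ℕ.+-cancelˡ-≡ v _ _ (trans (cong (_+ _) (sym cval≡v)) (trans (exc-split π) exc≡v+d))

  -- The non-fixed points number `exc π + exc (flip π)`. Each summand contains the `v` cyclic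
  -- valleys, the rest being double ascents in the first and double descents in the second.
  class-unfixed : ∀ d → InClass (v + d) π → 2 * v + (d + doubleAscents (flip π)) ≡ unfixed
  class-unfixed {π = π} d (type , cval≡v , exc≡v+d) = sym (begin
    n ∸ count (ℕ._≟ 1) (parts μ)
      ≡⟨ cong (n ∸_) (sym (HasCycleType⇒fixed {π = π} μ type)) ⟩
    n ∸ fixed π
      ≡⟨ cong (_∸ fixed π) (sym (exc+exc+fixed π)) ⟩
    exc π + exc (flip π) + fixed π ∸ fixed π
      ≡⟨ ℕ.m+n∸n≡m _ (fixed π) ⟩
    exc π + exc (flip π)
      ≡⟨ cong₂ _+_ exc≡v+d (trans (sym (exc-split (flip π))) (cong (_+ u) (trans (cval-flip π) cval≡v))) ⟩
    (v + d) + (v + u)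
      ≡⟨ solve 3 (λ v d u → (v :+ d) :+ (v :+ u) := con 2 :* v :+ (d :+ u)) refl v d u ⟩
    2 * v + (d + u) ∎)
    where
    open ≡-Reasoning
    open +-*-Solver
    u = doubleAscents (flip π)

  -- Both sides count pairs of a permutation and one of its double ascents
  -- (respectively double descents), and hopping matches these pairs.

  classSize-recurrence : ∀ d → classSize (v + suc d) * suc d ≡
                               classSize (v + d) * (unfixed ∸ 2 * v ∸ d)
  classSize-recurrence d = begin
    classSize (v + suc d) * suc d
      ≡⟨ sym (count-product (inClass? (v + suc d)) isDoubleAscent? (allFin n) (suc d)
           (λ {π} → class-doubleAscents {π = π} (suc d)) (permutations n)) ⟩
    count (λ (π , x) → inClass? (v + suc d) π ×-dec isDoubleAscent? π x) pairs
      ≡⟨ count-≡ {R = λ (π , x) (π′ , x′) → x ≡ x′ × Hop x π π′} _ _ unique unique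
           (λ { {_} {_} (refl , hop) (refl , hop′) → Hop-injective hop hop′ , refl })
           (λ { {_} {_} (refl , hop) (refl , hop′) → Hop-functional hop hop′ , refl })
           total surjective
           (λ { {π , x} {π′ , _} ((type , cv , ex) , _) (refl , hop) →
             ( subst (λ c → c ↭ parts μ) (Hop-cycleLengths hop) type
             , trans (sym (Hop-cval hop)) cv
             , ℕ.suc-injective (trans (sym (Hop-exc hop)) (trans ex (ℕ.+-suc v d))))
             , Hop-doubleDescent hop })
           (λ { {π′ , _} {π , x} ((type , cv , ex) , _) (refl , hop) →
             ( subst (λ c → c ↭ parts μ) (sym (Hop-cycleLengths hop)) type
             , trans (Hop-cval hop) cv
             , trans (Hop-exc hop) (trans (cong suc ex) (sym (ℕ.+-suc v d))))
             , Hop-doubleAscent hop }) ⟩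
    count (λ (π , x) → inClass? (v + d) π ×-dec isDoubleAscent? (flip π) x) pairs
      ≡⟨ count-product (inClass? (v + d)) (isDoubleAscent? ∘ flip) (allFin n) (unfixed ∸ 2 * v ∸ d)
           (λ {π} → descents {π}) (permutations n) ⟩
    classSize (v + d) * (unfixed ∸ 2 * v ∸ d) ∎
    where
    open ≡-Reasoning
    pairs : List (Permutation′ n × Fin n)
    pairs = cartesianProduct (permutations n) (allFin n)

    unique = UniqueSetoid.cartesianProduct⁺ (permutationSetoid n) (setoid (Fin n))
               (permutations-unique n) (Unique.allFin⁺ n)

    -- A member of the class makes `class-unfixed` available, so the truncated subtractions are
    -- exact. An empty class asks for nothing.
    descents : InClass (v + d) π → doubleAscents (flip π) ≡ unfixed ∸ 2 * v ∸ d
    descents {π} π∈ = sym (trans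
      (cong (λ m → m ∸ 2 * v ∸ d) (sym (class-unfixed {π = π} d π∈)))
      (trans (cong (_∸ d) (ℕ.m+n∸m≡n (2 * v) _)) (ℕ.m+n∸m≡n d _)))

    total : ∀ {π,x} → InClass (v + suc d) (proj₁ π,x) × IsDoubleAscent (proj₁ π,x) (proj₂ π,x) →
            Any (λ (π′ , x′) → proj₂ π,x ≡ x′ × Hop (proj₂ π,x) (proj₁ π,x) π′) pairs
    total {π , x} (_ , asc) = let π′ , hop = IsDoubleAscent⇒Hop {π = π} asc in
      -- `π′` occurs in the list only up to pointwise equality, so the hop is transported to the
      -- listed copy.
      Any.map (λ (π′≈ , x≡) → x≡ , Hop-respʳ π′≈ hop)
        (Any.cartesianProduct⁺ (permutations-complete π′) (∈-allFin x))

    surjective : ∀ {π′,x} →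
                 InClass (v + d) (proj₁ π′,x) × IsDoubleAscent (flip (proj₁ π′,x)) (proj₂ π′,x) →
                 Any (λ (π , x) → x ≡ proj₂ π′,x × Hop x π (proj₁ π′,x)) pairs
    -- A double descent of `π′` is a double ascent of its inverse. Hopping there gives `σ`, and the
    -- inverse of `σ` hops to `π′`.
    surjective {π′ , x} (_ , desc) = let σ , hop = IsDoubleAscent⇒Hop {π = flip π′} desc in
      Any.map (λ { {π , _} (π≈ , refl) →
          refl , Hop-flip {π = flip π′} (Hop-respʳ (≈ₚ-flip σ (flip π) π≈) hop) })
        (Any.cartesianProduct⁺ (permutations-complete (flip σ)) (∈-allFin x))

-- Coefficients of polynomials

-- The fragment of the semiring laws that passes from R to polynomials over R
-- without a proof of associativity or distributivity.

record SemiringLaws (R : RawSemiring 0ℓ 0ℓ) : Set where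
  open RawSemiring R renaming (_+_ to _⊕_; _*_ to _⊗_)
  field
    isEquivalence : IsEquivalence _≈_
    +-cong        : ∀ {w x y z} → w ≈ x → y ≈ z → (w ⊕ y) ≈ (x ⊕ z)
    +-identityˡ   : ∀ x → (0# ⊕ x) ≈ x
    +-identityʳ   : ∀ x → (x ⊕ 0#) ≈ x
    *-congʳ       : ∀ {x y z} → x ≈ y → (x ⊗ z) ≈ (y ⊗ z)
    *-identityˡ   : ∀ x → (1# ⊗ x) ≈ x
    zeroˡ         : ∀ x → (0# ⊗ x) ≈ 0#
    zeroʳ         : ∀ x → (x ⊗ 0#) ≈ 0#

  asSetoid : Setoid 0ℓ 0ℓ
  asSetoid = record { isEquivalence = isEquivalence }

  open IsEquivalence isEquivalence public

module Polynomials {R : RawSemiring 0ℓ 0ℓ} (laws : SemiringLaws R) where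
  private
    module R = RawSemiring R
    module P = RawSemiring (polynomials R)
    module L = SemiringLaws laws
  open SemiringOps (polynomials R) using (_^_)
  open SetoidReasoning L.asSetoid

  private
    coeff = coefficient R

  coefficient-add : ∀ p q k → coeff (p P.+ q) k R.≈ (coeff p k R.+ coeff q k)
  coefficient-add []      q       k       = L.sym (L.+-identityˡ _)
  coefficient-add (x ∷ p) []      k       = L.sym (L.+-identityʳ _)
  coefficient-add (x ∷ p) (y ∷ q) zero    = L.refl
  coefficient-add (x ∷ p) (y ∷ q) (suc k) = coefficient-add p q k

  coefficient-scale : ∀ x p k → coeff (map (x R.*_) p) k R.≈ (x R.* coeff p k)
  coefficient-scale x []      k       = L.sym (L.zeroʳ x)
  coefficient-scale x (y ∷ p) zero    = L.refl
  coefficient-scale x (y ∷ p) (suc k) = coefficient-scale x p k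

  coefficient-mul : ∀ x p q k →
    coeff ((x ∷ p) P.* q) k R.≈ ((x R.* coeff q k) R.+ coeff (R.0# ∷ (p P.* q)) k)
  coefficient-mul x p q k = L.trans (coefficient-add (map (x R.*_) q) _ k)
                                    (L.+-cong (coefficient-scale x q k) L.refl)

  0∷-cong : ∀ {p q} → p P.≈ q → (R.0# ∷ p) P.≈ (R.0# ∷ q)
  0∷-cong p≈q zero    = L.refl
  0∷-cong p≈q (suc k) = p≈q k

  0∷0≈0 : ∀ {p} → p P.≈ P.0# → (R.0# ∷ p) P.≈ P.0#
  0∷0≈0 p≈0 zero    = L.refl
  0∷0≈0 p≈0 (suc k) = p≈0 k

  -- A polynomial equal to zero may be a nonempty list of zeros, so this does not hold by
  -- computation. It settles the case of unequal lengths in `mul-congʳ`.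
  mul-zeroˡ : ∀ p q → p P.≈ P.0# → (p P.* q) P.≈ P.0#
  mul-zeroˡ []      q p≈0 k = L.refl
  mul-zeroˡ (x ∷ p) q p≈0 k = begin
    coeff ((x ∷ p) P.* q) k
      ≈⟨ coefficient-mul x p q k ⟩
    (x R.* coeff q k) R.+ coeff (R.0# ∷ (p P.* q)) k
      ≈⟨ L.+-cong (L.trans (L.*-congʳ (p≈0 0)) (L.zeroˡ _))
                   (0∷0≈0 (mul-zeroˡ p q λ l → p≈0 (suc l)) k) ⟩
    R.0# R.+ R.0#
      ≈⟨ L.+-identityˡ _ ⟩
    R.0# ∎

  mul-congʳ : ∀ p p′ q → p P.≈ p′ → (p P.* q) P.≈ (p′ P.* q)
  mul-congʳ []      p′       q p≈p′ k = L.sym (mul-zeroˡ p′ q (λ l → L.sym (p≈p′ l)) k)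
  mul-congʳ (x ∷ p) []       q p≈p′ k = mul-zeroˡ (x ∷ p) q p≈p′ k
  mul-congʳ (x ∷ p) (y ∷ p′) q p≈p′ k = begin
    coeff ((x ∷ p) P.* q) k
      ≈⟨ coefficient-mul x p q k ⟩
    (x R.* coeff q k) R.+ coeff (R.0# ∷ (p P.* q)) k
      ≈⟨ L.+-cong (L.*-congʳ (p≈p′ 0)) (0∷-cong (mul-congʳ p p′ q (λ l → p≈p′ (suc l))) k) ⟩
    (y R.* coeff q k) R.+ coeff (R.0# ∷ (p′ P.* q)) k
      ≈⟨ L.sym (coefficient-mul y p′ q k) ⟩
    coeff ((y ∷ p′) P.* q) k ∎

  coefficient-const : ∀ x q k → coeff (constant R x P.* q) k R.≈ (x R.* coeff q k)
  coefficient-const x q k = L.trans (coefficient-mul x [] q k)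
    (L.trans (L.+-cong L.refl (0∷0≈0 (λ _ → L.refl) k)) (L.+-identityʳ _))

  mul-identityˡ : ∀ q → (P.1# P.* q) P.≈ q
  mul-identityˡ q k = L.trans (coefficient-const R.1# q k) (L.*-identityˡ _)

  mul-0∷ : ∀ p q → ((R.0# ∷ p) P.* q) P.≈ (R.0# ∷ (p P.* q))
  mul-0∷ p q k = L.trans (coefficient-mul R.0# p q k)
                         (L.trans (L.+-cong (L.zeroˡ _) L.refl) (L.+-identityˡ _))

  indeterminate-mul : ∀ q → (indeterminate R P.* q) P.≈ (R.0# ∷ q)
  indeterminate-mul q k = L.trans (mul-0∷ P.1# q k) (0∷-cong (mul-identityˡ q) k)

  -- Multiplication by the `j`-th power of the indeterminate, in a form whose coefficients compute.
  shift : ℕ → P.Carrier → P.Carrier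
  shift zero    q = q
  shift (suc j) q = R.0# ∷ shift j q

  indeterminate^-mul : ∀ j q → ((indeterminate R ^ j) P.* q) P.≈ shift j q
  indeterminate^-mul zero    q k = mul-identityˡ q k
  indeterminate^-mul (suc j) q k =
    L.trans (mul-congʳ (indeterminate R P.* (indeterminate R ^ j)) (R.0# ∷ (indeterminate R ^ j)) q
              (indeterminate-mul (indeterminate R ^ j)) k)
      (L.trans (mul-0∷ (indeterminate R ^ j) q k) (0∷-cong (indeterminate^-mul j q) k))

  indeterminate^ : ∀ j → (indeterminate R ^ j) P.≈ shift j P.1#
  indeterminate^ zero    k = L.refl
  indeterminate^ (suc j) k =
    L.trans (indeterminate-mul (indeterminate R ^ j) k) (0∷-cong (indeterminate^ j) k)

  coefficient-shift-< : ∀ {j k} q → k ℕ.< j → coeff (shift j q) k ≡ R.0#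
  coefficient-shift-< {suc j} {zero}  q _           = ≡.refl
  coefficient-shift-< {suc j} {suc k} q (ℕ.s≤s k<j) = coefficient-shift-< q k<j

  coefficient-shift-+ : ∀ j d q → coeff (shift j q) (j ℕ.+ d) ≡ coeff q d
  coefficient-shift-+ zero    d q = ≡.refl
  coefficient-shift-+ (suc j) d q = coefficient-shift-+ j d q

  coefficient-shift-self : ∀ j x → coeff (shift j (constant R x)) j ≡ x
  coefficient-shift-self zero    x = ≡.refl
  coefficient-shift-self (suc j) x = coefficient-shift-self j x

  coefficient-shift-constant : ∀ {j k} x → j ≢ k → coeff (shift j (constant R x)) k ≡ R.0#
  coefficient-shift-constant {zero}  {zero}  x j≢k = contradiction ≡.refl j≢k
  coefficient-shift-constant {zero}  {suc k} x j≢k = ≡.refl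
  coefficient-shift-constant {suc j} {zero}  x j≢k = ≡.refl
  coefficient-shift-constant {suc j} {suc k} x j≢k = coefficient-shift-constant x (j≢k ∘ ≡.cong suc)

  polynomials-laws : SemiringLaws (polynomials R)
  polynomials-laws = record
    { isEquivalence = record
      { refl  = λ _ → L.refl
      ; sym   = λ p≈q k → L.sym (p≈q k)
      ; trans = λ p≈q q≈r k → L.trans (p≈q k) (q≈r k)
      }
    ; +-cong      = λ {w} {x} {y} {z} w≈x y≈z k → L.trans (coefficient-add w y k)
                      (L.trans (L.+-cong (w≈x k) (y≈z k)) (L.sym (coefficient-add x z k)))
    ; +-identityˡ = λ _ _ → L.refl
    ; +-identityʳ = λ p k → L.trans (coefficient-add p [] k) (L.+-identityʳ _)
    ; *-congʳ     = λ {p} {p′} {q} → mul-congʳ p p′ q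
    ; *-identityˡ = mul-identityˡ
    ; zeroˡ       = λ _ _ → L.refl
    ; zeroʳ       = λ p → mul-zeroʳ p
    }
    where
    mul-zeroʳ : ∀ p → (p P.* P.0#) P.≈ P.0#
    mul-zeroʳ []      k = L.refl
    mul-zeroʳ (x ∷ p) k = 0∷0≈0 (mul-zeroʳ p) k

ℤ-laws : SemiringLaws ℤ.+-*-rawSemiring
ℤ-laws = record
  { isEquivalence = ≡.isEquivalence
  ; +-cong        = ≡.cong₂ ℤ._+_
  ; +-identityˡ   = ℤ.+-identityˡ
  ; +-identityʳ   = ℤ.+-identityʳ
  ; *-congʳ       = ≡.cong (ℤ._* _)
  ; *-identityˡ   = ℤ.*-identityˡ
  ; zeroˡ         = ℤ.*-zeroˡ
  ; zeroʳ         = ℤ.*-zeroʳ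
  }

-- Binomial coefficients and their recurrence

-- The absorption identity with the subtracted term moved to the left, so that Pascal's rule and
-- semiring arithmetic carry the induction on `m`.
C-absorption-+ : ∀ m k → suc k * (m C suc k) + k * (m C k) ≡ m * (m C k)
C-absorption-+ zero    zero    = refl
C-absorption-+ zero    (suc k) = cong₂ _+_ (ℕ.*-zeroʳ (2 + k)) (ℕ.*-zeroʳ (1 + k))
C-absorption-+ (suc m) zero    = begin
  1 * (suc m C 1) + 0 ≡⟨ trans (ℕ.+-identityʳ _) (ℕ.*-identityˡ _) ⟩
  suc m C 1           ≡⟨ nC1≡n (suc m) ⟩
  suc m               ≡⟨ sym (ℕ.*-identityʳ (suc m)) ⟩
  suc m * 1           ∎
  where open ≡-Reasoning
C-absorption-+ (suc m) (suc k) = begin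
  (2 + k) * (suc m C (2 + k)) + (1 + k) * (suc m C (1 + k))
    ≡⟨ sym (cong₂ (λ p q → (2 + k) * p + (1 + k) * q)
         (nCk+nC[k+1]≡[n+1]C[k+1] m (1 + k)) (nCk+nC[k+1]≡[n+1]C[k+1] m k)) ⟩
  (2 + k) * (b + c) + (1 + k) * (a + b)
    ≡⟨ solve 4 (λ k a b c → (con 2 :+ k) :* (b :+ c) :+ (con 1 :+ k) :* (a :+ b) :=
         (((con 2 :+ k) :* c :+ (con 1 :+ k) :* b) :+ ((con 1 :+ k) :* b :+ k :* a)) :+ (a :+ b))
         refl k a b c ⟩
  ((2 + k) * c + (1 + k) * b) + ((1 + k) * b + k * a) + (a + b)
    ≡⟨ cong₂ (λ p q → p + q + (a + b)) (C-absorption-+ m (suc k)) (C-absorption-+ m k) ⟩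
  m * b + m * a + (a + b)
    ≡⟨ solve 3 (λ m a b → m :* b :+ m :* a :+ (a :+ b) := (con 1 :+ m) :* (a :+ b)) refl m a b ⟩
  suc m * (a + b)
    ≡⟨ cong (suc m *_) (nCk+nC[k+1]≡[n+1]C[k+1] m k) ⟩
  suc m * (suc m C suc k) ∎
  where
  open ≡-Reasoning
  open +-*-Solver
  a = m C k
  b = m C suc k
  c = m C (2 + k)

C-absorption : ∀ m k → (m C suc k) * suc k ≡ (m C k) * (m ∸ k)
C-absorption m k = begin
  (m C suc k) * suc k                               ≡⟨ ℕ.*-comm (m C suc k) (suc k) ⟩
  suc k * (m C suc k)                               ≡⟨ sym (ℕ.m+n∸n≡m _ (k * (m C k))) ⟩
  suc k * (m C suc k) + k * (m C k) ∸ k * (m C k) ≡⟨ cong (_∸ k * (m C k)) (C-absorption-+ m k) ⟩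
  m * (m C k) ∸ k * (m C k)                         ≡⟨ sym (ℕ.*-distribʳ-∸ (m C k) m k) ⟩
  (m ∸ k) * (m C k)                                 ≡⟨ ℕ.*-comm (m ∸ k) (m C k) ⟩
  (m C k) * (m ∸ k)                                 ∎
  where open ≡-Reasoning

-- By `C-absorption` both sides obey the same recurrence and agree at 0; the factor `suc k` cancels.
recurrence⇒binomial : ∀ m (f : ℕ → ℕ) → (∀ k → f (suc k) * suc k ≡ f k * (m ∸ k)) →
                      ∀ k → f k ≡ f 0 * (m C k)
recurrence⇒binomial m f rec zero    = sym (ℕ.*-identityʳ (f 0))
recurrence⇒binomial m f rec (suc k) = ℕ.*-cancelʳ-≡ _ _ (suc k) (begin
  f (suc k) * suc k               ≡⟨ rec k ⟩
  f k * (m ∸ k)                   ≡⟨ cong (_* (m ∸ k)) (recurrence⇒binomial m f rec k) ⟩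
  f 0 * (m C k) * (m ∸ k)         ≡⟨ ℕ.*-assoc (f 0) _ _ ⟩
  f 0 * ((m C k) * (m ∸ k))       ≡⟨ cong (f 0 *_) (sym (C-absorption m k)) ⟩
  f 0 * ((m C suc k) * suc k)     ≡⟨ sym (ℕ.*-assoc (f 0) _ _) ⟩
  f 0 * (m C suc k) * suc k       ∎)
  where open ≡-Reasoning

-- Sums, powers of 1 + t and γ-expansions

module _ {R : RawSemiring 0ℓ 0ℓ} (laws : SemiringLaws R) where
  open RawSemiring R using (Carrier; _≈_; 0#)
  open SemiringOps R using (sum)
  open SemiringLaws laws

  sum-zero : ∀ {n} (f : Vector Carrier n) → (∀ j → f j ≈ 0#) → sum f ≈ 0#
  sum-zero {zero}  f f≈0 = SemiringLaws.refl laws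
  sum-zero {suc n} f f≈0 = SemiringLaws.trans laws
    (+-cong (f≈0 zero) (sum-zero (f ∘ suc) (f≈0 ∘ suc))) (+-identityˡ 0#)

  sum-single : ∀ {n} (f : Vector Carrier n) i → (∀ j → j ≢ i → f j ≈ 0#) → sum f ≈ f i
  sum-single {suc n} f zero    f≈0 = SemiringLaws.trans laws
    (+-cong (SemiringLaws.refl laws) (sum-zero (f ∘ suc) λ j → f≈0 (suc j) λ ())) (+-identityʳ _)
  sum-single {suc n} f (suc i) f≈0 = SemiringLaws.trans laws
    (+-cong (f≈0 zero λ ()) (sum-single (f ∘ suc) i λ j j≢i → f≈0 (suc j) (j≢i ∘ Fin.suc-injective)))
    (+-identityˡ _)

module T = Polynomials ℤ-laws
module S = Polynomials T.polynomials-laws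

1+t : ℤ[t].Carrier
1+t = ℤ[t].1# ℤ[t].+ ℤ[t].t

coeff : ℤ[t].Carrier → ℕ → ℤ
coeff = coefficient ℤ.+-*-rawSemiring

coefficient-[1+t]^ : ∀ m k → coeff (1+t ℤ[t].^ m) k ≡ + (m C k)
coefficient-[1+t]^ zero    zero    = refl
coefficient-[1+t]^ zero    (suc k) = refl
coefficient-[1+t]^ (suc m) k       = begin
  coeff (1+t ℤ[t].* p) k
    -- `1+t` computes to the list `+ 1 ∷ ℤ[t].1#`, so the product is `p` plus its shift, and
    -- coefficients obey Pascal's rule.
    ≡⟨ T.coefficient-mul (+ 1) ℤ[t].1# p k ⟩
  + 1 ℤ.* coeff p k ℤ.+ coeff (+ 0 ∷ (ℤ[t].1# ℤ[t].* p)) k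
    ≡⟨ cong₂ ℤ._+_ (ℤ.*-identityˡ (coeff p k)) (T.0∷-cong {ℤ[t].1# ℤ[t].* p} {p} (T.mul-identityˡ p) k) ⟩
  coeff p k ℤ.+ coeff (+ 0 ∷ p) k
    ≡⟨ pascal k ⟩
  + (suc m C k) ∎
  where
  open ≡-Reasoning
  p = 1+t ℤ[t].^ m

  pascal : ∀ k → coeff p k ℤ.+ coeff (+ 0 ∷ p) k ≡ + (suc m C k)
  pascal zero    = cong (ℤ._+ + 0) (coefficient-[1+t]^ m 0)
  pascal (suc k) = begin
    coeff p (suc k) ℤ.+ coeff p k
      ≡⟨ cong₂ ℤ._+_ (coefficient-[1+t]^ m (suc k)) (coefficient-[1+t]^ m k) ⟩
    + ((m C suc k) + (m C k))
      ≡⟨ cong +_ (trans (ℕ.+-comm (m C suc k) _) (nCk+nC[k+1]≡[n+1]C[k+1] m k)) ⟩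
    + (suc m C suc k) ∎

γ-basis : ∀ m → Fin (suc ⌊ m /2⌋) → ℤ[t].Carrier
γ-basis m j = (ℤ[t].t ℤ[t].^ toℕ j) ℤ[t].* (1+t ℤ[t].^ (m ∸ 2 * toℕ j))

γ-expansion : ∀ m → Vector ℕ (suc ⌊ m /2⌋) → Vector ℤ[t].Carrier (suc ⌊ m /2⌋)
γ-expansion m γ j = ℤ[t].const (+ γ j) ℤ[t].* γ-basis m j

-- For nonzero `c` the γ-expansion has the single term with index `v` and coefficient `c`. The bound
-- on `v` is asked only then: when `c` is zero, `f` vanishes and `v` may lie outside the index
-- range.
γ-positive-binomial : ∀ f m v c → (c ≢ 0 → v ℕ.≤ ⌊ m /2⌋) →
                      (∀ k → k ℕ.< v → coeff f k ≡ + 0) →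
                      (∀ d → coeff f (v + d) ≡ + (c * ((m ∸ 2 * v) C d))) → γ-Positive f
γ-positive-binomial f m v c bound low high with c ℕ.≟ 0
... | yes refl = m , (λ _ → 0) , λ k → trans (f≈0 k)
    (sym (sum-zero T.polynomials-laws (γ-expansion m (λ _ → 0))
      (λ j → T.coefficient-const (+ 0) (γ-basis m j)) k))
  where
  f≈0 : ∀ k → coeff f k ≡ + 0
  f≈0 k with k ℕ.<? v
  ... | yes k<v = low k k<v
  ... | no  k≮v = subst (λ k → coeff f k ≡ + 0) (ℕ.m+[n∸m]≡n (ℕ.≮⇒≥ k≮v)) (high (k ∸ v))
... | no c≢0 = m , γ , λ k → trans (f≈ k) (sym (trans
    (sum-single T.polynomials-laws (γ-expansion m γ) i vanish k)
    (T.coefficient-const (+ γ i) (γ-basis m i) k)))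
  where
  i : Fin (suc ⌊ m /2⌋)
  i = fromℕ< (ℕ.s≤s (bound c≢0))

  γ : Vector ℕ (suc ⌊ m /2⌋)
  γ j = if does (j ≟ i) then c else 0

  vanish : ∀ j → j ≢ i → γ-expansion m γ j ℤ[t].≈ ℤ[t].0#
  vanish j j≢i k rewrite dec-false (j ≟ i) j≢i = T.coefficient-const (+ 0) (γ-basis m j) k

  q : ℤ[t].Carrier
  q = 1+t ℤ[t].^ (m ∸ 2 * v)

  f≈ : ∀ k → coeff f k ≡ + γ i ℤ.* coeff (γ-basis m i) k
  -- The rewrites replace `γ i` by `c`, `toℕ i` by `v` and the product with a power of `t` by a
  -- shift.
  f≈ k rewrite dec-true (i ≟ i) refl | Fin.toℕ-fromℕ< (ℕ.s≤s (bound c≢0))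
             | T.indeterminate^-mul v q k with k ℕ.<? v
  ... | yes k<v = trans (low k k<v)
                    (sym (trans (cong (+ c ℤ.*_) (T.coefficient-shift-< q k<v)) (ℤ.*-zeroʳ (+ c))))
  ... | no  k≮v = subst (λ k → coeff f k ≡ + c ℤ.* coeff (T.shift v q) k)
                    (ℕ.m+[n∸m]≡n (ℕ.≮⇒≥ k≮v)) (begin
    coeff f (v + d)
      ≡⟨ high d ⟩
    + (c * ((m ∸ 2 * v) C d))
      ≡⟨ ℤ.pos-* c _ ⟩
    + c ℤ.* + ((m ∸ 2 * v) C d)
      ≡⟨ cong (+ c ℤ.*_) (sym (trans (T.coefficient-shift-+ v d q) (coefficient-[1+t]^ (m ∸ 2 * v) d))) ⟩
    + c ℤ.* coeff (T.shift v q) (v + d) ∎)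
    where
    open ≡-Reasoning
    d = k ∸ v

-- The generating function

-- Each permutation adds 1 to the coefficient at its own pair of statistics and 0 to all others.
coefficient-∑ : ∀ {n} (πs : List (Permutation′ n)) i k →
  coeff (ℤ[t][s].[s^ i ] (∑[s^cval·t^exc] πs)) k ≡
  + count (λ π → cval π ℕ.≟ i ×-dec exc π ℕ.≟ k) πs
coefficient-∑     []       i k = refl
coefficient-∑ {n} (π ∷ πs) i k = begin
  coeff (coefficient ℤ[t] (monomial ℤ[t][s].+ ∑[s^cval·t^exc] πs) i) k
    ≡⟨ S.coefficient-add monomial (∑[s^cval·t^exc] πs) i k ⟩
  coeff (coefficient ℤ[t] monomial i ℤ[t].+ coefficient ℤ[t] (∑[s^cval·t^exc] πs) i) k
    ≡⟨ T.coefficient-add (coefficient ℤ[t] monomial i) _ k ⟩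
  coeff (coefficient ℤ[t] monomial i) k ℤ.+ coeff (coefficient ℤ[t] (∑[s^cval·t^exc] πs) i) k
    ≡⟨ cong₂ ℤ._+_ (S.indeterminate^-mul (cval π) (ℤ[t][s].const t^exc) i k) (coefficient-∑ πs i k) ⟩
  coeff (coefficient ℤ[t] (S.shift (cval π) (ℤ[t][s].const t^exc)) i) k ℤ.+ + count stats? πs
    ≡⟨ step (cval π ℕ.≟ i) (exc π ℕ.≟ k) ⟩
  + count stats? (π ∷ πs) ∎
  where
  open ≡-Reasoning
  stats? : Decidable (λ (π : Permutation′ n) → cval π ≡ i × exc π ≡ k)
  stats? π = cval π ℕ.≟ i ×-dec exc π ℕ.≟ k

  t^exc : ℤ[t].Carrier
  t^exc = ℤ[t].t ℤ[t].^ exc π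

  monomial : ℤ[t][s].Carrier
  monomial = (ℤ[t][s].s ℤ[t][s].^ cval π) ℤ[t][s].* ℤ[t][s].const t^exc

  miss : ∀ {z} → z ≡ + 0 → ¬ (cval π ≡ i × exc π ≡ k) →
         z ℤ.+ + count stats? πs ≡ + count stats? (π ∷ πs)
  miss refl ¬stats = trans (ℤ.+-identityˡ _) (cong +_ (sym (count-reject stats? πs ¬stats)))

  hit : ∀ {z} → z ≡ + 1 → cval π ≡ i × exc π ≡ k →
        z ℤ.+ + count stats? πs ≡ + count stats? (π ∷ πs)
  hit refl stats = cong +_ (sym (count-accept stats? πs stats))

  step : Dec (cval π ≡ i) → Dec (exc π ≡ k) →
         coeff (coefficient ℤ[t] (S.shift (cval π) (ℤ[t][s].const t^exc)) i) k ℤ.+ + count stats? πs ≡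
         + count stats? (π ∷ πs)
  step (no c≢i)   _ = miss
    (cong (λ p → coeff p k) (S.coefficient-shift-constant t^exc c≢i)) (c≢i ∘ proj₁)
  step (yes refl) (no e≢k) = miss
    (trans (cong (λ p → coeff p k) (S.coefficient-shift-self (cval π) t^exc))
    (trans (T.indeterminate^ (exc π) k) (T.coefficient-shift-constant (+ 1) e≢k))) (e≢k ∘ proj₂)
  step (yes refl) (yes refl) = hit
    (trans (cong (λ p → coeff p k) (S.coefficient-shift-self (cval π) t^exc))
    (trans (T.indeterminate^ (exc π) k) (T.coefficient-shift-self (exc π) (+ 1)))) (refl , refl)

corollary8 : (n : ℕ) .{{_ : NonZero n}} (μ : Partition n) (i : ℕ) →
    γ-Positive (ℤ[t][s].[s^ i ] (∑[s^cval·t^exc] (𝔖 n μ)))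
corollary8 n μ i = γ-positive-binomial
  -- The centre is half the number of non-fixed points. `i + 0` is left unsimplified to match the
  -- value of `λ d → size (i + d)` at 0.
  (ℤ[t][s].[s^ i ] (∑[s^cval·t^exc] (𝔖 n μ))) (unfixed n μ i) i (size (i + 0)) bound
  -- Coefficients below `i` vanish because every cyclic valley is an excedance.
  (λ k k<i → trans (coefficients k) (cong +_ (count-none (inClass? n μ i k)
    (λ {π} π∈ → ℕ.<⇒≱ k<i (cval≤exc {π = π} π∈)) (permutations n))))
  (λ d → trans (coefficients (i + d)) (cong +_
    (recurrence⇒binomial (unfixed n μ i ∸ 2 * i) (λ d → size (i + d)) (classSize-recurrence n μ i) d)))
  where
  size : ℕ → ℕ
  size = classSize n μ i

  coefficients : ∀ k → coeff (ℤ[t][s].[s^ i ] (∑[s^cval·t^exc] (𝔖 n μ))) k ≡ + size k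
  coefficients k = trans (coefficient-∑ (𝔖 n μ) i k)
    (cong +_ (count-filter (λ π → cval π ℕ.≟ i ×-dec exc π ℕ.≟ k) (hasCycleType? μ) (permutations n)))

  cval≤exc : ∀ {k π} → InClass n μ i k π → i ℕ.≤ k
  cval≤exc {π = π} (_ , refl , refl) = ℕ.m+n≤o⇒m≤o (cval π) (ℕ.≤-reflexive (exc-split π))

  bound : size (i + 0) ≢ 0 → i ℕ.≤ ⌊ unfixed n μ i /2⌋
  bound size≢0 =
    -- A member of the class with no double ascents has `2 * i` plus its double descents equal to
    -- `unfixed`, so `i` is a valid index.
    let π , π∈ = count≢0⇒∃ (inClass? n μ i (i + 0)) (permutations n) size≢0 in
    subst (ℕ._≤ ⌊ unfixed n μ i /2⌋) (sym (ℕ.n≡⌊n+n/2⌋ i)) (ℕ.⌊n/2⌋-mono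
      (subst (ℕ._≤ unfixed n μ i) (cong (λ j → i + j) (ℕ.+-identityʳ i))
        (ℕ.m+n≤o⇒m≤o (2 * i) (ℕ.≤-reflexive (class-unfixed n μ i {π = π} 0 π∈)))))
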